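{- Let $G$ be a finite simple graph of order $2n$ with a perfect matching, and suppose $F(G)=k$ where $0\leq k\leq n-1$. Then $$e(G)\geq \frac{n(n+1)}{n-k}-k-1.$$
   Context: For a graph $G$ with a perfect matching $M$, a subset $S\subseteq M$ is a forcing set of $M$ if $S$ is contained in no perfect matching of $G$ other than $M$. $f(G,M)$ is the minimum size of a forcing set of $M$, and $F(G)=\max_M f(G,M)$ over all perfect matchings $M$ of $G$. $e(G)$ is the number of edges. -}

module Defs where

open import Data.Nat using (ℕ; _≤_; _<_)
open import Data.Bool using (Bool; true; false; _∧_)
open import Data.Fin using (Fin; toℕ)
open import Data.Fin.Properties using () renaming (_<?_ to _<ᶠ?_)
open import Data.List using (List; length; filter; allFin; concatMap; map)
open import Data.Product using (Σ; _×_; _,_; ∃)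
open import Relation.Binary.PropositionalEquality using (_≡_)
open import Relation.Nullary using (¬_; does)

record SimpleGraph (m : ℕ) : Set where
  field
    Adj    : Fin m → Fin m → Bool
    sym    : ∀ i j → Adj i j ≡ Adj j i
    irrefl : ∀ i → Adj i i ≡ false
open SimpleGraph public

EdgeSet : ℕ → Set
EdgeSet m = Fin m → Fin m → Bool

orderedPairs : (m : ℕ) → List (Fin m × Fin m)
orderedPairs m =
  filter (λ p → Data.Product.proj₁ p <ᶠ? Data.Product.proj₂ p)
    (concatMap (λ i → map (λ j → (i , j)) (allFin m)) (allFin m))

-- number of (unordered) edges of a symmetric edge set
edgeCount : {m : ℕ} → EdgeSet m → ℕ
edgeCount {m} E = length (filter (λ p → E (Data.Product.proj₁ p) (Data.Product.proj₂ p) Data.Bool.≟ true) (orderedPairs m))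

e : {m : ℕ} → SimpleGraph m → ℕ
e G = edgeCount (Adj G)

_⊆ₑ_ : {m : ℕ} → EdgeSet m → EdgeSet m → Set
_⊆ₑ_ {m} S T = ∀ (i j : Fin m) → S i j ≡ true → T i j ≡ true

SymmetricE : {m : ℕ} → EdgeSet m → Set
SymmetricE {m} S = ∀ (i j : Fin m) → S i j ≡ S j i

_≈ₑ_ : {m : ℕ} → EdgeSet m → EdgeSet m → Set
_≈ₑ_ {m} S T = ∀ (i j : Fin m) → S i j ≡ T i j

IsPerfectMatching : {m : ℕ} → SimpleGraph m → EdgeSet m → Set
IsPerfectMatching {m} G M =
  SymmetricE M × (M ⊆ₑ Adj G) ×
  (∀ (i : Fin m) → Σ (Fin m) λ j → M i j ≡ true × (∀ j′ → M i j′ ≡ true → j′ ≡ j))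

IsForcingSet : {m : ℕ} → SimpleGraph m → EdgeSet m → EdgeSet m → Set
IsForcingSet {m} G M S =
  SymmetricE S × (S ⊆ₑ M) ×
  (∀ M′ → IsPerfectMatching G M′ → S ⊆ₑ M′ → M′ ≈ₑ M)

ForcingNumberIs : {m : ℕ} → SimpleGraph m → EdgeSet m → ℕ → Set
ForcingNumberIs G M r =
  (Σ _ λ S → IsForcingSet G M S × edgeCount S ≡ r) ×
  (∀ S → IsForcingSet G M S → r ≤ edgeCount S)

MaxForcingNumberIs : {m : ℕ} → SimpleGraph m → ℕ → Set
MaxForcingNumberIs G k =
  (Σ _ λ M → IsPerfectMatching G M × ForcingNumberIs G M k) ×
  (∀ M r → IsPerfectMatching G M → ForcingNumberIs G M r → r ≤ k)

HasPerfectMatching : {m : ℕ} → SimpleGraph m → Set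
HasPerfectMatching G = Σ _ λ M → IsPerfectMatching G M

{-# OPTIONS --safe #-}

-- The stronger bound n² ≤ e(G) (n − k) holds, by a greedy argument in the style of Caro and Wei.
-- Fix a matching M with f(G,M) = k. Among the vertices of a union R of M-edges choose v of least
-- degree, and remove from R the block of all M-edges of R meeting the neighbourhood of v. Put
-- every removed edge except vv′ (v′ the mate of v) into S. Then S forces M: once the earlier
-- blocks are matched as in M, every neighbour of v other than v′ is already taken.
-- A block of b edges satisfies b ≤ d(v), and its vertices have degree at least d(v), so its
-- degree sum is at least 2b². If there are t blocks, Cauchy–Schwarz gives n² ≤ t e(G), while
-- n − t = |S| ≥ k.
module Submission where

open import Defs
open import Data.Nat using (ℕ; zero; suc; _+_; _*_; _∸_; _≤_; _<_; z≤n; s≤s; >-nonZero)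
open import Data.Nat.Properties
open import Data.Nat.Tactic.RingSolver using (solve-∀)
open import Data.Bool using (Bool; true; false; _∧_; _∨_; not) renaming (_≟_ to _≟ᵇ_)
open import Data.Bool.Properties using (⇔→≡; ∨-comm; ∧-zeroʳ)
open import Data.Fin as Fin using (Fin)
import Data.Fin.Properties as Fin
open import Data.Fin.Permutation using (permutation)
open import Data.List using (List; []; [_]; _++_; length; filter; concatMap; map; tabulate)
open import Data.List.Properties using (filter-++; length-++)
open import Data.Product using (_×_; _,_; proj₁; proj₂; ∃)
open import Data.Sum using (_⊎_; inj₁; inj₂; [_,_]′)
open import Function using (_∘_; const; mk⇔)
open import Relation.Binary.Definitions using (tri<; tri≈; tri>)
open import Relation.Binary.PropositionalEquality
  using (_≡_; _≢_; refl; trans; cong; cong₂; subst; module ≡-Reasoning) renaming (sym to ≡-sym)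
open import Relation.Nullary using (yes; no; does; contradiction)
open import Relation.Nullary.Decidable using (dec-true; dec-false)
open import Algebra.Properties.Semiring.Sum +-*-semiring
  using (sum; sum-syntax; sum-cong-≗; ∑-distrib-+; ∑-comm; ∑-permute; *-distribʳ-sum)

-- Cardinalities and weights as sums of indicators.

χ : Bool → ℕ
χ true  = 1
χ false = 0

card : ∀ {m} → (Fin m → Bool) → ℕ
card {m} P = ∑[ i < m ] χ (P i)

weight : ∀ {m} → (Fin m → ℕ) → (Fin m → Bool) → ℕ
weight {m} f P = ∑[ i < m ] (χ (P i) * f i)

sum-mono-≤ : ∀ {m} {f g : Fin m → ℕ} → (∀ i → f i ≤ g i) → sum f ≤ sum g
sum-mono-≤ {zero}  f≤g = z≤n
sum-mono-≤ {suc m} f≤g = +-mono-≤ (f≤g Fin.zero) (sum-mono-≤ (f≤g ∘ Fin.suc))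

sum-zero : ∀ m → ∑[ i < m ] 0 ≡ 0
sum-zero zero    = refl
sum-zero (suc m) = sum-zero m

card-all : ∀ m → card {m} (const true) ≡ m
card-all zero    = refl
card-all (suc m) = cong suc (card-all m)

card-∘ : ∀ {m} {μ : Fin m → Fin m} → (∀ i → μ (μ i) ≡ i) →
         ∀ P → card (P ∘ μ) ≡ card P
card-∘ {μ = μ} inv P = ≡-sym (∑-permute (χ ∘ P) (permutation μ μ inv inv))

card-singleton : ∀ {m} (v : Fin m) → card (λ u → does (u Fin.≟ v)) ≡ 1
card-singleton {suc m} Fin.zero    = cong suc (sum-zero m)
card-singleton {suc m} (Fin.suc v) = card-singleton v

-- The first alternative is what stops the greedy recursion; the second supplies its vertex of least
-- degree.
∃-minimizer : ∀ {m} (P : Fin m → Bool) (f : Fin m → ℕ) →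
  (∀ i → P i ≡ false) ⊎ (∃ λ v → P v ≡ true × (∀ u → P u ≡ true → f v ≤ f u))
∃-minimizer {zero} P f = inj₁ λ ()
∃-minimizer {suc m} P f with P Fin.zero in eq | ∃-minimizer (P ∘ Fin.suc) (f ∘ Fin.suc)
... | false | inj₁ none = inj₁ λ { Fin.zero → eq ; (Fin.suc i) → none i }
... | false | inj₂ (v , Pv , least) = inj₂ (Fin.suc v , Pv , λ
  { Fin.zero P0 → contradiction (trans (≡-sym eq) P0) λ () ; (Fin.suc u) → least u })
... | true | inj₁ none = inj₂ (Fin.zero , eq , λ
  { Fin.zero _ → ≤-refl ; (Fin.suc u) Pu → contradiction (trans (≡-sym (none u)) Pu) λ () })
... | true | inj₂ (v , Pv , least) with ≤-total (f Fin.zero) (f (Fin.suc v))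
...   | inj₁ f0≤fv = inj₂ (Fin.zero , eq , λ
  { Fin.zero _ → ≤-refl ; (Fin.suc u) Pu → ≤-trans f0≤fv (least u Pu) })
...   | inj₂ fv≤f0 = inj₂ (Fin.suc v , Pv , λ
  { Fin.zero _ → fv≤f0 ; (Fin.suc u) → least u })

-- Nonnegativity of (y - x)², expanded with y = x + z when x ≤ y; the other order follows by
-- symmetry.
2xy≤x²+y² : ∀ x y → 2 * (x * y) ≤ x * x + y * y
2xy≤x²+y² x y = [ ordered , swapped ∘ ordered ]′ (≤-total x y)
  where
  square : ∀ x z → 2 * (x * (x + z)) + z * z ≡ x * x + (x + z) * (x + z)
  square = solve-∀
  ordered : ∀ {x y} → x ≤ y → 2 * (x * y) ≤ x * x + y * y
  ordered {x} {y} x≤y = subst (λ y → 2 * (x * y) ≤ x * x + y * y) (m+[n∸m]≡n x≤y)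
    (m+n≤o⇒m≤o _ (≤-reflexive (square x (y ∸ x))))
  swapped : 2 * (y * x) ≤ y * y + x * x → 2 * (x * y) ≤ x * x + y * y
  swapped rewrite *-comm y x | +-comm (y * y) (x * x) = λ le → le

-- Degrees, edge counts and the handshake identity.

deg : ∀ {m} → SimpleGraph m → Fin m → ℕ
deg G i = card (Adj G i)

module _ {B : Set} (ϕ : List B → ℕ) (ϕ-[] : ϕ [] ≡ 0) (ϕ-++ : ∀ xs ys → ϕ (xs ++ ys) ≡ ϕ xs + ϕ ys) where

  additive-concatMap : ∀ {A : Set} {m} (g : Fin m → A) (h : A → List B) →
    ϕ (concatMap h (tabulate g)) ≡ ∑[ i < m ] ϕ (h (g i))
  additive-concatMap {m = zero}  g h = ϕ-[]
  additive-concatMap {m = suc m} g h =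
    trans (ϕ-++ (h (g Fin.zero)) _)
          (cong (ϕ (h (g Fin.zero)) +_) (additive-concatMap (g ∘ Fin.suc) h))

  additive-map : ∀ {A : Set} {m} (g : Fin m → A) (h : A → B) →
    ϕ (map h (tabulate g)) ≡ ∑[ i < m ] ϕ [ h (g i) ]
  additive-map {m = zero}  g h = ϕ-[]
  additive-map {m = suc m} g h =
    trans (ϕ-++ [ h (g Fin.zero) ] _)
          (cong (ϕ [ h (g Fin.zero) ] +_) (additive-map (g ∘ Fin.suc) h))

-- Filtering followed by `length` is additive under `++`, so the count passes through `concatMap`
-- and `map` and only singleton lists remain to be evaluated.
edgeCount≡∑ : ∀ {m} (E : EdgeSet m) →
  edgeCount E ≡ ∑[ i < m ] ∑[ j < m ] χ (does (i Fin.<? j) ∧ E i j)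
edgeCount≡∑ {m} E =
  trans (additive-concatMap ϕ refl ϕ-++ (λ i → i) (λ i → map (λ j → (i , j)) (tabulate λ j → j)))
        (sum-cong-≗ λ i →
          trans (additive-map ϕ refl ϕ-++ (λ j → j) (λ j → (i , j)))
                (sum-cong-≗ λ j → ϕ-pair i j))
  where
  E? = λ (p : Fin m × Fin m) → E (proj₁ p) (proj₂ p) ≟ᵇ true
  ascending? = λ (p : Fin m × Fin m) → proj₁ p Fin.<? proj₂ p
  ϕ : List (Fin m × Fin m) → ℕ
  ϕ ps = length (filter E? (filter ascending? ps))
  ϕ-++ : ∀ ps qs → ϕ (ps ++ qs) ≡ ϕ ps + ϕ qs
  ϕ-++ ps qs rewrite filter-++ ascending? ps qs | filter-++ E? (filter ascending? ps) (filter ascending? qs) =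
    length-++ (filter E? (filter ascending? ps))
  ϕ-pair : ∀ i j → ϕ [ (i , j) ] ≡ χ (does (i Fin.<? j) ∧ E i j)
  ϕ-pair i j with does (i Fin.<? j)
  ... | false = refl
  ... | true with E i j
  ...   | true  = refl
  ...   | false = refl

-- Each entry of `E` is charged to the order of its endpoints. Exchanging the two summations shows
-- that the ascending and the descending entries are equally many.
handshake : ∀ {m} (E : EdgeSet m) → SymmetricE E → (∀ i → E i i ≡ false) →
  ∑[ i < m ] card (E i) ≡ 2 * edgeCount E
handshake {m} E E-sym E-irrefl = begin
  ∑[ i < m ] card (E i)
    ≡⟨ sum-cong-≗ (λ i → trans (sum-cong-≗ (split i)) (∑-distrib-+ (up i) (λ j → up j i))) ⟩
  ∑[ i < m ] (∑[ j < m ] up i j + ∑[ j < m ] up j i)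
    ≡⟨ ∑-distrib-+ (λ i → ∑[ j < m ] up i j) (λ i → ∑[ j < m ] up j i) ⟩
  X + ∑[ i < m ] ∑[ j < m ] up j i
    ≡⟨ cong (X +_) (∑-comm (λ i j → up j i)) ⟩
  X + X
    ≡⟨ cong₂ _+_ (edgeCount≡∑ E) (trans (+-identityʳ _) (edgeCount≡∑ E)) ⟨
  2 * edgeCount E ∎
  where
  open ≡-Reasoning
  up : Fin m → Fin m → ℕ
  up i j = χ (does (i Fin.<? j) ∧ E i j)
  X = ∑[ i < m ] ∑[ j < m ] up i j
  split : ∀ i j → χ (E i j) ≡ up i j + up j i
  split i j with Fin.<-cmp i j
  ... | tri< i<j _ i≯j
    rewrite dec-true (i Fin.<? j) i<j | dec-false (j Fin.<? i) i≯j = ≡-sym (+-identityʳ _)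
  ... | tri> i≮j _ j<i
    rewrite dec-false (i Fin.<? j) i≮j | dec-true (j Fin.<? i) j<i = cong χ (E-sym i j)
  ... | tri≈ i≮i refl _
    rewrite dec-false (i Fin.<? i) i≮i = cong χ (E-irrefl i)

-- Perfect matchings as involutions along edges.

IsMatchingMap : ∀ {m} → SimpleGraph m → (Fin m → Fin m) → Set
IsMatchingMap G μ = (∀ i → μ (μ i) ≡ i) × (∀ i → Adj G i (μ i) ≡ true)

module PerfectMatching {m} (G : SimpleGraph m) (M : EdgeSet m) (pm : IsPerfectMatching G M) where

  M-sym : SymmetricE M
  M-sym = proj₁ pm

  M⊆Adj : M ⊆ₑ Adj G
  M⊆Adj = proj₁ (proj₂ pm)

  mate : Fin m → Fin m
  mate i = proj₁ (proj₂ (proj₂ pm) i)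

  matched : ∀ i → M i (mate i) ≡ true
  matched i = proj₁ (proj₂ (proj₂ (proj₂ pm) i))

  mate-unique : ∀ i j → M i j ≡ true → j ≡ mate i
  mate-unique i = proj₂ (proj₂ (proj₂ (proj₂ pm) i))

  isMatchingMap : IsMatchingMap G mate
  isMatchingMap =
    (λ i → ≡-sym (mate-unique (mate i) i (trans (M-sym (mate i) i) (matched i)))) ,
    (λ i → M⊆Adj i (mate i) (matched i))

-- The greedy decomposition into blocks.

module Greedy {m} (G : SimpleGraph m) (μ : Fin m → Fin m) (μ-matching : IsMatchingMap G μ) where

  μ-inv : ∀ i → μ (μ i) ≡ i
  μ-inv = proj₁ μ-matching

  μ-adj : ∀ i → Adj G i (μ i) ≡ true
  μ-adj = proj₂ μ-matching

  -- Closed sets are the vertex sets of subsets of the matching.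
  Closed : (Fin m → Bool) → Set
  Closed P = ∀ i → P (μ i) ≡ P i

  -- t counts the edges of the matching lying inside R but not inside U.
  -- The field bound is Cauchy–Schwarz linearised in card R, so that it adds up over the blocks;
  -- it is homogeneous in a and c because the optimal ratio c / a = 2n / (n − k) need not be an integer.
  record Reduction (R : Fin m → Bool) : Set where
    field
      U        : Fin m → Bool
      t        : ℕ
      U-closed : Closed U
      count    : card U + 2 * t ≤ card R
      bound    : ∀ a c → 2 * (a * c) * card R ≤ 2 * (a * a) * weight (deg G) R + c * c * t
      forces   : ∀ σ → IsMatchingMap G σ →
                 (∀ i → R i ≡ false ⊎ U i ≡ true → σ i ≡ μ i) → ∀ i → σ i ≡ μ i

  -- Apply 2xy ≤ x² + y² with x = ab and y = c, then b² ≤ 2bd ≤ 2w. Here `b` counts vertices, twice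
  -- the matching edges of a block, and the single c² pays for the one edge the block adds to `t`.
  block-bound : ∀ a c {b d w} → b ≤ 2 * d → b * d ≤ w →
                2 * (a * c) * b ≤ 2 * (a * a) * w + c * c
  block-bound a c {b} {d} {w} b≤2d bd≤w = begin
    2 * (a * c) * b                 ≡⟨ e₁ a c b ⟩
    2 * ((a * b) * c)               ≤⟨ 2xy≤x²+y² (a * b) c ⟩
    (a * b) * (a * b) + c * c       ≡⟨ cong (_+ c * c) (e₂ a b) ⟩
    (a * a) * (b * b) + c * c       ≤⟨ +-monoˡ-≤ _ (*-monoʳ-≤ (a * a) (*-monoʳ-≤ b b≤2d)) ⟩
    (a * a) * (b * (2 * d)) + c * c ≡⟨ cong (_+ c * c) (e₃ (a * a) b d) ⟩
    2 * (a * a) * (b * d) + c * c   ≤⟨ +-monoˡ-≤ _ (*-monoʳ-≤ (2 * (a * a)) bd≤w) ⟩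
    2 * (a * a) * w + c * c         ∎
    where
    open ≤-Reasoning
    e₁ : ∀ a c b → 2 * (a * c) * b ≡ 2 * ((a * b) * c)
    e₁ = solve-∀
    e₂ : ∀ a b → (a * b) * (a * b) ≡ (a * a) * (b * b)
    e₂ = solve-∀
    e₃ : ∀ x b d → x * (b * (2 * d)) ≡ 2 * x * (b * d)
    e₃ = solve-∀

  module Step (R : Fin m → Bool) (R-closed : Closed R) (v : Fin m) (Rv : R v ≡ true)
              (v-least : ∀ u → R u ≡ true → deg G v ≤ deg G u) where

    -- `near` tests a vertex together with its mate, so that `block` consists of whole matching
    -- edges. `pair` is the edge from `v` to its mate, and `dropped` holds the other block edges,
    -- which go into the forcing set.
    near block pair rest dropped : Fin m → Bool
    near u    = Adj G v u ∨ Adj G v (μ u)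
    block u   = R u ∧ near u
    rest u    = R u ∧ not (near u)
    pair u    = does (u Fin.≟ v) ∨ does (μ u Fin.≟ v)
    dropped u = block u ∧ not (pair u)

    near-closed : Closed near
    near-closed u rewrite μ-inv u = ∨-comm (Adj G v (μ u)) (Adj G v u)

    block-closed : Closed block
    block-closed u = cong₂ _∧_ (R-closed u) (near-closed u)

    rest-closed : Closed rest
    rest-closed u = cong₂ (λ x y → x ∧ not y) (R-closed u) (near-closed u)

    pair-closed : Closed pair
    pair-closed u rewrite μ-inv u = ∨-comm (does (μ u Fin.≟ v)) (does (u Fin.≟ v))

    dropped-closed : Closed dropped
    dropped-closed u = cong₂ (λ x y → x ∧ not y) (block-closed u) (pair-closed u)

    v≢μv : v ≢ μ v
    v≢μv v≡μv with () ← trans (≡-sym (trans (cong (Adj G v) v≡μv) (μ-adj v))) (irrefl G v)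

    near-v : near v ≡ true
    near-v rewrite μ-adj v = ∨-comm (Adj G v v) true

    block-v : block v ≡ true
    block-v rewrite Rv = near-v

    pair⊆block : ∀ u → pair u ≡ true → block u ≡ true
    pair⊆block u _ with u Fin.≟ v | μ u Fin.≟ v
    pair⊆block u _  | yes refl | _        = block-v
    pair⊆block u _  | no _     | yes μu≡v =
      trans (≡-sym (block-closed u)) (trans (cong block μu≡v) block-v)
    pair⊆block u () | no _     | no _

    card-pair : card pair ≡ 2
    card-pair = begin
      card pair                             ≡⟨ sum-cong-≗ disjoint ⟩
      ∑[ u < m ] (χ (is-v u) + χ (is-v (μ u))) ≡⟨ ∑-distrib-+ (χ ∘ is-v) (χ ∘ is-v ∘ μ) ⟩
      card is-v + card (is-v ∘ μ)           ≡⟨ cong (card is-v +_) (card-∘ {μ = μ} μ-inv is-v) ⟩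
      card is-v + card is-v                 ≡⟨ cong₂ _+_ (card-singleton v) (card-singleton v) ⟩
      2                                     ∎
      where
      open ≡-Reasoning
      is-v : Fin m → Bool
      is-v u = does (u Fin.≟ v)
      disjoint : ∀ u → χ (pair u) ≡ χ (is-v u) + χ (is-v (μ u))
      disjoint u with u Fin.≟ v | μ u Fin.≟ v
      ... | yes refl | yes μv≡v = contradiction (≡-sym μv≡v) v≢μv
      ... | yes _    | no _     = refl
      ... | no _     | yes _    = refl
      ... | no _     | no _     = refl

    χ-split : ∀ u → χ (R u) ≡ χ (rest u) + χ (block u)
    χ-split u with R u | near u
    ... | false | _     = refl
    ... | true  | false = refl
    ... | true  | true  = refl

    card-split : card R ≡ card rest + card block
    card-split = trans (sum-cong-≗ χ-split) (∑-distrib-+ (χ ∘ rest) (χ ∘ block))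

    weight-split : weight (deg G) R ≡ weight (deg G) rest + weight (deg G) block
    weight-split = trans
      (sum-cong-≗ λ u → trans (cong (_* deg G u) (χ-split u)) (*-distribʳ-+ (deg G u) (χ (rest u)) _))
      (∑-distrib-+ (λ u → χ (rest u) * deg G u) (λ u → χ (block u) * deg G u))

    card-block : card block ≡ card dropped + 2
    card-block = trans (sum-cong-≗ split)
      (trans (∑-distrib-+ (χ ∘ dropped) (χ ∘ pair)) (cong (card dropped +_) card-pair))
      where
      split : ∀ u → χ (block u) ≡ χ (dropped u) + χ (pair u)
      split u with block u | pair u | pair⊆block u
      ... | true  | true  | _ = refl
      ... | true  | false | _ = refl
      ... | false | false | _ = refl
      ... | false | true  | p with () ← p refl

    -- The block is covered by the neighbourhood of `v` and its image under `μ`, two sets of size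
    -- `deg G v`.
    card-block≤ : card block ≤ 2 * deg G v
    card-block≤ = begin
      card block                                              ≤⟨ sum-mono-≤ cover ⟩
      ∑[ u < m ] (χ (Adj G v u) + χ (Adj G v (μ u)))          ≡⟨ ∑-distrib-+ (χ ∘ Adj G v) (χ ∘ Adj G v ∘ μ) ⟩
      deg G v + card (Adj G v ∘ μ)                            ≡⟨ cong (deg G v +_) (card-∘ {μ = μ} μ-inv (Adj G v)) ⟩
      deg G v + deg G v                                       ≡⟨ cong (deg G v +_) (+-identityʳ _) ⟨
      2 * deg G v                                             ∎
      where
      open ≤-Reasoning
      cover : ∀ u → χ (block u) ≤ χ (Adj G v u) + χ (Adj G v (μ u))
      cover u with R u | Adj G v u | Adj G v (μ u)
      ... | false | _     | _     = z≤n
      ... | true  | false | false = z≤n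
      ... | true  | false | true  = ≤-refl
      ... | true  | true  | _     = s≤s z≤n

    weight-block≥ : card block * deg G v ≤ weight (deg G) block
    weight-block≥ = ≤-trans
      (≤-reflexive (*-distribʳ-sum (deg G v) (χ ∘ block)))
      (sum-mono-≤ heavier)
      where
      heavier : ∀ u → χ (block u) * deg G v ≤ χ (block u) * deg G u
      heavier u with R u in Ru | near u
      ... | false | _     = z≤n
      ... | true  | false = z≤n
      ... | true  | true  = *-monoʳ-≤ 1 (v-least u Ru)

    -- The block contains at least `v` and its mate; this strict decrease makes the recursion
    -- terminate.
    card-rest< : card rest < card R
    card-rest< rewrite card-split | card-block | +-comm (card dropped) 2 =
      m<m+n (card rest) (s≤s z≤n)

    extend : Reduction rest → Reduction R
    extend red = record
      { U = U
      ; t = suc t′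
      ; U-closed = λ u → cong₂ _∨_ (U′-closed u) (dropped-closed u)
      ; count = count
      ; bound = bound
      ; forces = forces
      }
      where
      open Reduction red using () renaming
        (U to U′; t to t′; U-closed to U′-closed; count to count′; bound to bound′; forces to forces′)
      U : Fin m → Bool
      U u = U′ u ∨ dropped u

      χ-∨ : ∀ x y → χ (x ∨ y) ≤ χ x + χ y
      χ-∨ false y = ≤-refl
      χ-∨ true  y = s≤s z≤n

      count : card U + 2 * suc t′ ≤ card R
      count = begin
        card U + 2 * suc t′
          ≤⟨ +-monoˡ-≤ _ (sum-mono-≤ λ u → χ-∨ (U′ u) (dropped u)) ⟩
        ∑[ u < m ] (χ (U′ u) + χ (dropped u)) + 2 * suc t′
          ≡⟨ cong (_+ 2 * suc t′) (∑-distrib-+ (χ ∘ U′) (χ ∘ dropped)) ⟩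
        card U′ + card dropped + 2 * suc t′
          ≡⟨ regroup (card U′) (card dropped) t′ ⟩
        card U′ + 2 * t′ + (card dropped + 2)
          ≤⟨ +-monoˡ-≤ _ count′ ⟩
        card rest + (card dropped + 2)
          ≡⟨ cong (card rest +_) card-block ⟨
        card rest + card block
          ≡⟨ card-split ⟨
        card R ∎
        where
        open ≤-Reasoning
        regroup : ∀ x y t → x + y + 2 * suc t ≡ x + 2 * t + (y + 2)
        regroup = solve-∀

      bound : ∀ a c → 2 * (a * c) * card R ≤ 2 * (a * a) * weight (deg G) R + c * c * suc t′
      bound a c = begin
        2 * (a * c) * card R
          ≡⟨ cong (2 * (a * c) *_) card-split ⟩
        2 * (a * c) * (card rest + card block)
          ≡⟨ *-distribˡ-+ (2 * (a * c)) (card rest) (card block) ⟩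
        2 * (a * c) * card rest + 2 * (a * c) * card block
          ≤⟨ +-mono-≤ (bound′ a c) (block-bound a c card-block≤ weight-block≥) ⟩
        2 * (a * a) * weight (deg G) rest + c * c * t′ + (2 * (a * a) * weight (deg G) block + c * c)
          ≡⟨ regroup (2 * (a * a)) (weight (deg G) rest) (weight (deg G) block) (c * c) t′ ⟩
        2 * (a * a) * (weight (deg G) rest + weight (deg G) block) + c * c * suc t′
          ≡⟨ cong (λ w → 2 * (a * a) * w + c * c * suc t′) weight-split ⟨
        2 * (a * a) * weight (deg G) R + c * c * suc t′ ∎
        where
        open ≤-Reasoning
        regroup : ∀ x w w′ y t → x * w + y * t + (x * w′ + y) ≡ x * (w + w′) + y * suc t
        regroup = solve-∀

      -- To apply the hypothesis for `rest`, agreement must be extended to the whole block.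
      -- `dropped` lies in `U`, so only `v` and its mate are left.
      forces : ∀ σ → IsMatchingMap G σ →
        (∀ i → R i ≡ false ⊎ U i ≡ true → σ i ≡ μ i) → ∀ i → σ i ≡ μ i
      forces σ σ-matching@(σ-inv , σ-adj) fixed = forces′ σ σ-matching fixed′
        where
        -- Agreement at σ i passes to i, because both maps are involutions: μ (σ i) = σ (σ i) = i.
        swap : ∀ {i} → σ (σ i) ≡ μ (σ i) → σ i ≡ μ i
        swap {i} eq = trans (≡-sym (μ-inv (σ i))) (cong μ (trans (≡-sym eq) (σ-inv i)))

        -- Every neighbour of v other than μ v lies outside R or in U, where σ agrees with μ.
        fixed-v : σ v ≡ μ v
        fixed-v with R (σ v) in Rσv | pair (σ v) in pσv
        ... | false | _     = swap (fixed (σ v) (inj₁ Rσv))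
        ... | true  | false = swap (fixed (σ v) (inj₂ Uσv))
          where
          Uσv : U (σ v) ≡ true
          Uσv rewrite Rσv | σ-adj v | pσv = ∨-comm (U′ (σ v)) true
        ... | true  | true with σ v Fin.≟ v | μ (σ v) Fin.≟ v
        ...   | yes σv≡v | _ with () ← trans (≡-sym (trans (cong (Adj G v) (≡-sym σv≡v)) (σ-adj v))) (irrefl G v)
        ...   | no _ | yes μσv≡v = trans (≡-sym (μ-inv (σ v))) (cong μ μσv≡v)

        fixed-pair : ∀ i → pair i ≡ true → σ i ≡ μ i
        fixed-pair i _ with i Fin.≟ v | μ i Fin.≟ v
        fixed-pair i _  | yes refl | _ = fixed-v
        fixed-pair i () | no _ | no _
        fixed-pair i _  | no _ | yes μi≡v = begin
          σ i         ≡⟨ cong σ (trans (≡-sym (μ-inv i)) (cong μ μi≡v)) ⟩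
          σ (μ v)     ≡⟨ cong σ fixed-v ⟨
          σ (σ v)     ≡⟨ σ-inv v ⟩
          v           ≡⟨ μi≡v ⟨
          μ i         ∎
          where open ≡-Reasoning

        fixed′ : ∀ i → rest i ≡ false ⊎ U′ i ≡ true → σ i ≡ μ i
        fixed′ i (inj₂ U′i) = fixed i (inj₂ (cong (_∨ dropped i) U′i))
        fixed′ i (inj₁ ¬rest) with pair i in p | R i in Ri | near i in ni
        ... | true  | _     | _    = fixed-pair i p
        ... | false | false | _    = fixed i (inj₁ Ri)
        ... | false | true  | true = fixed i (inj₂ Ui)
          where
          Ui : U i ≡ true
          Ui rewrite Ri | ni | p = ∨-comm (U′ i) true
        fixed′ i (inj₁ ()) | false | true | false

  -- The bound `s` on `card R` serves as fuel. It cannot run out while `R` is nonempty, since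
  -- `card rest` is strictly smaller than `card R`.
  reduce : ∀ s (R : Fin m → Bool) → Closed R → card R ≤ s → Reduction R
  reduce s R R-closed ≤s with ∃-minimizer R (deg G)
  reduce s R R-closed ≤s | inj₁ empty = record
    { U = R
    ; t = 0
    ; U-closed = R-closed
    ; count = ≤-reflexive (+-identityʳ _)
    ; bound = λ a c → ≤-trans (≤-reflexive (trans (cong (2 * (a * c) *_) card-R) (*-zeroʳ (2 * (a * c))))) z≤n
    ; forces = λ σ _ fixed i → fixed i (inj₁ (empty i))
    }
    where
    card-R : card R ≡ 0
    card-R = trans (sum-cong-≗ λ i → cong χ (empty i)) (sum-zero m)
  reduce zero R R-closed ≤s | inj₂ (v , Rv , least) =
    contradiction (≤-trans (Step.card-rest< R R-closed v Rv least) ≤s) n≮0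
  reduce (suc s) R R-closed ≤s | inj₂ (v , Rv , least) =
    extend (reduce s rest rest-closed (≤-pred (≤-trans card-rest< ≤s)))
    where open Step R R-closed v Rv least

-- From closed vertex sets to forcing sets.

module _ {m} (G : SimpleGraph m) (M : EdgeSet m) (pm : IsPerfectMatching G M) where
  open PerfectMatching G M pm
  open Greedy G mate isMatchingMap

  -- Testing one endpoint is enough for closed `U`, which contains both ends of a matching edge or
  -- neither.
  edgesWithin : (Fin m → Bool) → EdgeSet m
  edgesWithin U i j = M i j ∧ U i

  edgesWithin⊆M : ∀ U → edgesWithin U ⊆ₑ M
  edgesWithin⊆M U i j Sij with M i j
  ... | true = refl

  edgesWithin-sym : ∀ {U} → Closed U → SymmetricE (edgesWithin U)
  edgesWithin-sym {U} U-closed i j rewrite M-sym j i with M i j in Mij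
  ... | false = refl
  ... | true  = trans (≡-sym (U-closed i)) (cong U (≡-sym (mate-unique i j Mij)))

  -- By the handshake identity it suffices to bound the rows: row i is empty outside `U` and has at
  -- most the entry `mate i` inside.
  edgeCount-edgesWithin : ∀ {U} → Closed U → 2 * edgeCount (edgesWithin U) ≤ card U
  edgeCount-edgesWithin {U} U-closed = begin
    2 * edgeCount S          ≡⟨ handshake S (edgesWithin-sym U-closed) S-irrefl ⟨
    ∑[ i < m ] card (S i)    ≤⟨ sum-mono-≤ row ⟩
    card U                   ∎
    where
    open ≤-Reasoning
    S = edgesWithin U
    S-irrefl : ∀ i → S i i ≡ false
    S-irrefl i with M i i in Mii
    ... | false = refl
    ... | true with () ← trans (≡-sym (M⊆Adj i i Mii)) (irrefl G i)
    row : ∀ i → card (S i) ≤ χ (U i)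
    row i with U i
    ... | false = ≤-reflexive (trans (sum-cong-≗ λ j → cong χ (∧-zeroʳ (M i j))) (sum-zero m))
    ... | true  = ≤-trans (sum-mono-≤ only-mate) (≤-reflexive (card-singleton (mate i)))
      where
      only-mate : ∀ j → χ (M i j ∧ true) ≤ χ (does (j Fin.≟ mate i))
      only-mate j with M i j in Mij
      ... | false = z≤n
      ... | true rewrite dec-true (j Fin.≟ mate i) (mate-unique i j Mij) = ≤-refl

  edgesWithin-forcing : (red : Reduction (const true)) → IsForcingSet G M (edgesWithin (Reduction.U red))
  edgesWithin-forcing red = edgesWithin-sym U-closed , edgesWithin⊆M U , unique
    where
    open Reduction red
    unique : ∀ M′ → IsPerfectMatching G M′ → edgesWithin U ⊆ₑ M′ → M′ ≈ₑ M
    unique M′ pm′ S⊆M′ i j = ⇔→≡ {z = true} (mk⇔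
      (λ M′ij → subst (λ x → M i x ≡ true) (≡-sym (trans (mate-unique′ i j M′ij) (same i))) (matched i))
      (λ Mij → subst (λ x → M′ i x ≡ true) (trans (same i) (≡-sym (mate-unique i j Mij))) (matched′ i)))
      where
      open PerfectMatching G M′ pm′ using () renaming
        (mate to mate′; mate-unique to mate-unique′; matched to matched′; isMatchingMap to isMatchingMap′)
      same : ∀ i → mate′ i ≡ mate i
      -- No vertex lies outside `const true`, so only vertices of `U` need checking; there the edge
      -- to the mate belongs to S and hence to `M′`.
      same = forces mate′ isMatchingMap′ λ where
        i (inj₂ Ui) → ≡-sym (mate-unique′ i (mate i) (S⊆M′ i (mate i) (cong₂ _∧_ (matched i) Ui)))

-- Optimising the bound and deducing the theorem.

n²≤e[n∸k] : ∀ n k (G : SimpleGraph (2 * n)) M → IsPerfectMatching G M →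
  (∀ S → IsForcingSet G M S → k ≤ edgeCount S) → k < n → n * n ≤ e G * (n ∸ k)
n²≤e[n∸k] n k G M pm k≤forcing k<n =
  *-cancelˡ-≤ 4 (*-cancelˡ-≤ T {{>-nonZero T>0}} (+-cancelʳ-≤ (2 * n * (2 * n) * T) _ _ (begin
    T * (4 * (n * n)) + 2 * n * (2 * n) * T         ≡⟨ e₁ T n ⟩
    2 * (T * (2 * n)) * (2 * n)                     ≡⟨ cong (2 * (T * (2 * n)) *_) (card-all (2 * n)) ⟨
    -- The choice a = n - k, c = 2n realises the optimal ratio. With degree sum 2e and t ≤ T this
    -- gives 8Tn² ≤ 4T²e + 4n²T; subtracting 4n²T and cancelling 4T leaves n² ≤ eT.
    2 * (T * (2 * n)) * card {2 * n} (const true)   ≤⟨ bound T (2 * n) ⟩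
    2 * (T * T) * weight (deg G) (const true) + 2 * n * (2 * n) * t
      ≤⟨ +-mono-≤ (≤-reflexive (cong (2 * (T * T) *_) total)) (*-monoʳ-≤ (2 * n * (2 * n)) t≤T) ⟩
    2 * (T * T) * (2 * e G) + 2 * n * (2 * n) * T   ≡⟨ cong (_+ 2 * n * (2 * n) * T) (e₂ T (e G)) ⟩
    T * (4 * (e G * T)) + 2 * n * (2 * n) * T       ∎)))
  where
  open ≤-Reasoning
  open PerfectMatching G M pm
  open Greedy G mate isMatchingMap
  red : Reduction (const true)
  red = reduce _ (const true) (λ _ → refl) ≤-refl
  open Reduction red
  T = n ∸ k
  T>0 : 0 < T
  T>0 = m<n⇒0<n∸m k<n
  k+t≤n : k + t ≤ n
  -- The edges within `U` form a forcing set, hence number at least k, while `U` has at most 2n - 2t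
  -- vertices.
  k+t≤n = *-cancelˡ-≤ 2 (begin
    2 * (k + t)                              ≡⟨ *-distribˡ-+ 2 k t ⟩
    2 * k + 2 * t
      ≤⟨ +-monoˡ-≤ (2 * t) (*-monoʳ-≤ 2 (k≤forcing _ (edgesWithin-forcing G M pm red))) ⟩
    2 * edgeCount (edgesWithin G M pm U) + 2 * t ≤⟨ +-monoˡ-≤ (2 * t) (edgeCount-edgesWithin G M pm U-closed) ⟩
    card U + 2 * t                           ≤⟨ count ⟩
    card {2 * n} (const true)                ≡⟨ card-all (2 * n) ⟩
    2 * n                                    ∎)
  t≤T : t ≤ T
  t≤T = ≤-trans (≤-reflexive (≡-sym (m+n∸m≡n k t))) (∸-monoˡ-≤ k k+t≤n)
  total : weight (deg G) (const true) ≡ 2 * e G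
  total = trans (sum-cong-≗ λ i → *-identityˡ (deg G i)) (handshake (Adj G) (SimpleGraph.sym G) (irrefl G))
  e₁ : ∀ T n → T * (4 * (n * n)) + 2 * n * (2 * n) * T ≡ 2 * (T * (2 * n)) * (2 * n)
  e₁ = solve-∀
  e₂ : ∀ T x → 2 * (T * T) * (2 * x) ≡ T * (4 * (x * T))
  e₂ = solve-∀

-- This is the stated inequality multiplied by n - k > 0, with k + 1 added to `e G` so that no
-- negative term appears. It is the sum of n² ≤ e(n - k) and n ≤ (k + 1)(n - k).
theorem3p4 : (n k : ℕ) (G : SimpleGraph (2 * n)) →
    HasPerfectMatching G → MaxForcingNumberIs G k → k < n →
    n * (n + 1) ≤ (e G + k + 1) * (n ∸ k)
theorem3p4 n k G _ ((M , pm , _ , k≤forcing) , _) k<n = begin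
  n * (n + 1)                   ≡⟨ trans (*-distribˡ-+ n n 1) (cong (n * n +_) (*-identityʳ n)) ⟩
  n * n + n                     ≤⟨ +-mono-≤ (n²≤e[n∸k] n k G M pm k≤forcing k<n) n≤[k+1]T ⟩
  e G * T + (k + 1) * T         ≡⟨ *-distribʳ-+ T (e G) (k + 1) ⟨
  (e G + (k + 1)) * T           ≡⟨ cong (_* T) (+-assoc (e G) k 1) ⟨
  (e G + k + 1) * T             ∎
  where
  open ≤-Reasoning
  T = n ∸ k
  n≤[k+1]T : n ≤ (k + 1) * T
  n≤[k+1]T = begin
    n               ≡⟨ m+[n∸m]≡n (<⇒≤ k<n) ⟨
    -- Uses k ≤ kT, valid as T ≥ 1.
    k + T           ≤⟨ +-monoˡ-≤ T (m≤m*n k T {{>-nonZero (m<n⇒0<n∸m k<n)}}) ⟩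
    k * T + T       ≡⟨ cong (k * T +_) (*-identityˡ T) ⟨
    k * T + 1 * T   ≡⟨ *-distribʳ-+ T k 1 ⟨
    (k + 1) * T     ∎
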